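{- Every connected graph $G$ has a spanning tree $T$ such that $BBC_2(G,T) = \chi(G)$ if $\chi(G)\ge 4$, and $BBC_2(G,T) = \chi(G)+1$ otherwise.
   Context: All graphs are simple. A proper $k$-coloring of a graph $G$ is a function $c: V(G)\to\{1,\ldots,k\}$ such that $c(u)\neq c(v)$ for every $uv\in E(G)$ (not all colors need be used), and $\chi(G)$ is the smallest positive integer $k$ for which $G$ has a proper $k$-coloring. Given a spanning subgraph $H$ of $G$ and a positive integer $k$, a $2$-backbone $k$-coloring of $(G,H)$ is a proper $k$-coloring $c$ of $G$ such that $|c(u)-c(v)|\ge 2$ for every $uv\in E(H)$. The $2$-backbone chromatic number $BBC_2(G,H)$ is the smallest integer $k$ for which $(G,H)$ admits a $2$-backbone $k$-coloring.
   Formalization: The connected graph G is required to have at least two vertices, because the claim fails for the one-vertex graph, where the chromatic number and the 2-backbone chromatic number are both 1. -}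

module Defs where

open import Data.Fin.Base using (Fin; toℕ; fromℕ<; finToFun; funToFin)
open import Data.Fin.Properties using (any?; all?; finToFun-funToFin; toℕ-fromℕ<; toℕ<n; toℕ-injective)
  renaming (_≟_ to _≟ᶠ_)
open import Data.List.Base using (List; _∷_; _∷ʳ_; length)
open import Data.List.Relation.Unary.Linked using (Linked)
open import Data.List.Relation.Unary.Unique.Propositional using (Unique)
open import Data.Nat.Base using (ℕ; suc; _*_; _≤_; _<_; z≤n; s≤s; ∣_-_∣)
open import Data.Nat.Properties
  using (_≤?_; ≤-trans; n≤1+n; *-monoʳ-<; *-monoʳ-≤; *-cancelˡ-≡; *-distribˡ-∣-∣;
         ∣m-n∣≡0⇒m≡n; n≢0⇒n>0; anyUpTo?; ≮⇒≥)
open import Data.Nat.Induction using (<-rec)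
open import Data.Product.Base using (∃; _×_; _,_; proj₁; proj₂)
open import Function.Base using (_∘_)
open import Level using (0ℓ)
open import Relation.Binary.Construct.Closure.ReflexiveTransitive using (Star)
open import Relation.Binary.Core using (Rel; _⇒_)
open import Relation.Binary.Definitions using (Decidable; Irreflexive; Symmetric)
open import Relation.Binary.PropositionalEquality using (_≡_; _≢_; refl; sym; trans; cong; subst; subst₂)
open import Relation.Nullary.Decidable using (Dec; yes; no; map′; _×-dec_; _→-dec_; ¬?)
open import Relation.Nullary.Negation using (¬_)
import Relation.Unary as U

record Graph (n : ℕ) : Set₁ where
  field
    Adj    : Rel (Fin n) 0ℓ
    irrefl : Irreflexive _≡_ Adj
    symm   : Symmetric Adj
    adj?   : Decidable Adj

record SpanningSubgraph {n : ℕ} (G : Graph n) : Set₁ where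
  field
    graph : Graph n
    sub   : Graph.Adj graph ⇒ Graph.Adj G

module _ {n : ℕ} (G : Graph n) where
  open Graph G

  Connected : Set
  Connected = ∀ u v → Star Adj u v

  -- The cycle with successive distinct vertices v , vs, closing up at v.
  IsCycle : Fin n → List (Fin n) → Set
  IsCycle v vs = 3 ≤ length (v ∷ vs) × Unique (v ∷ vs) × Linked Adj (v ∷ (vs ∷ʳ v))

  Acyclic : Set
  Acyclic = ∀ v vs → ¬ IsCycle v vs

  -- For n = 0 the empty graph satisfies this.
  IsTree : Set
  IsTree = Connected × Acyclic

  -- Colours are 0, …, k - 1 rather than 1, …, k.
  IsProper : ∀ k → (Fin n → Fin k) → Set
  IsProper k c = ∀ u v → Adj u v → c u ≢ c v

  Colourable : ℕ → Set
  Colourable k = ∃ λ (c : Fin n → Fin k) → IsProper k c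

module _ {n : ℕ} (G : Graph n) (H : SpanningSubgraph G) where
  open SpanningSubgraph H

  IsBackbone₂ : ∀ k → (Fin n → Fin k) → Set
  IsBackbone₂ k c =
    IsProper G k c × (∀ u v → Graph.Adj graph u v → 2 ≤ ∣ toℕ (c u) - toℕ (c v) ∣)

  Backbone₂Colourable : ℕ → Set
  Backbone₂Colourable k = ∃ λ (c : Fin n → Fin k) → IsBackbone₂ k c

IsLeast : (ℕ → Set) → ℕ → Set
IsLeast P k = P k × (∀ j → P j → k ≤ j)

least : {P : ℕ → Set} → U.Decidable P → ∃ P → ∃ (IsLeast P)
least {P} P? (m , pm) = <-rec (λ m → P m → ∃ (IsLeast P)) step m pm
  where
  step : ∀ m → (∀ {j} → j < m → P j → ∃ (IsLeast P)) → P m → ∃ (IsLeast P)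
  step m rec pm with anyUpTo? P? m
  ... | yes (j , j<m , pj) = rec j<m pj
  ... | no none = m , pm , λ j pj → ≮⇒≥ λ j<m → none (j , j<m , pj)

-- `resp` stands in for function extensionality.
anyFunction? : ∀ {n k} {P : (Fin n → Fin k) → Set} →
               (∀ {f g} → (∀ i → f i ≡ g i) → P f → P g) →
               U.Decidable P → Dec (∃ P)
anyFunction? resp P? = map′
  (λ (i , p) → finToFun i , p)
  (λ (f , p) → funToFin f , resp (sym ∘ finToFun-funToFin f) p)
  (any? (P? ∘ finToFun))

module _ {n : ℕ} (G : Graph n) where
  open Graph G

  isProper? : ∀ k → U.Decidable (IsProper G k)
  isProper? k c = all? λ u → all? λ v → adj? u v →-dec ¬? (c u ≟ᶠ c v)

  isProper-resp : ∀ k {f g : Fin n → Fin k} → (∀ i → f i ≡ g i) → IsProper G k f → IsProper G k g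
  isProper-resp k eq p u v a = subst₂ _≢_ (eq u) (eq v) (p u v a)

  colourable? : U.Decidable (Colourable G)
  colourable? k = anyFunction? (isProper-resp k) (isProper? k)

  χ-exists : ∃ (IsLeast (λ k → 1 ≤ k × Colourable G k))
  χ-exists = least (λ k → (1 ≤? k) ×-dec colourable? k) (suc n , s≤s z≤n , c , proper)
    where
    c : Fin n → Fin (suc n)
    c i = fromℕ< (≤-trans (toℕ<n i) (n≤1+n n))
    proper : IsProper G (suc n) c
    proper u v a eq = irrefl (toℕ-injective (subst₂ _≡_ (toℕ-fromℕ< _) (toℕ-fromℕ< _) (cong toℕ eq))) a

  χ : ℕ
  χ = proj₁ χ-exists

module _ {n : ℕ} (G : Graph n) (H : SpanningSubgraph G) where
  open SpanningSubgraph H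

  isBackbone₂? : ∀ k → U.Decidable (IsBackbone₂ G H k)
  isBackbone₂? k c = isProper? G k c ×-dec
    all? λ u → all? λ v → Graph.adj? graph u v →-dec (2 ≤? ∣ toℕ (c u) - toℕ (c v) ∣)

  isBackbone₂-resp : ∀ k {f g : Fin n → Fin k} → (∀ i → f i ≡ g i) →
                     IsBackbone₂ G H k f → IsBackbone₂ G H k g
  isBackbone₂-resp k eq (p , q) = isProper-resp G k eq p ,
    λ u v a → subst₂ (λ x y → 2 ≤ ∣ toℕ x - toℕ y ∣) (eq u) (eq v) (q u v a)

  backbone₂Colourable? : U.Decidable (Backbone₂Colourable G H)
  backbone₂Colourable? k = anyFunction? (isBackbone₂-resp k) (isBackbone₂? k)

  -- Giving vertex i the colour 2i shows that some number of colours suffices.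
  BBC₂-exists : ∃ (IsLeast (λ k → 1 ≤ k × Backbone₂Colourable G H k))
  BBC₂-exists = least (λ k → (1 ≤? k) ×-dec backbone₂Colourable? k)
                      (suc (2 * n) , s≤s z≤n , c , proper , backbone)
    where
    bound : ∀ i → 2 * toℕ {n} i < suc (2 * n)
    bound i = ≤-trans (*-monoʳ-< 2 (toℕ<n i)) (n≤1+n (2 * n))
    c : Fin n → Fin (suc (2 * n))
    c i = fromℕ< (bound i)
    c-val : ∀ i → toℕ (c i) ≡ 2 * toℕ i
    c-val i = toℕ-fromℕ< (bound i)
    proper : IsProper G (suc (2 * n)) c
    proper u v a eq = Graph.irrefl G (toℕ-injective (*-cancelˡ-≡ _ _ 2
      (trans (sym (c-val u)) (trans (cong toℕ eq) (c-val v))))) a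
    backbone : ∀ u v → Graph.Adj graph u v → 2 ≤ ∣ toℕ (c u) - toℕ (c v) ∣
    backbone u v a = subst₂ (λ x y → 2 ≤ ∣ x - y ∣) (sym (c-val u)) (sym (c-val v))
      (subst (2 ≤_) (*-distribˡ-∣-∣ 2 (toℕ u) (toℕ v))
        (*-monoʳ-≤ 2 (n≢0⇒n>0 λ eq → Graph.irrefl graph (toℕ-injective (∣m-n∣≡0⇒m≡n eq)) a)))

  BBC₂ : ℕ
  BBC₂ = proj₁ BBC₂-exists

{-# OPTIONS --safe #-}

-- Grow a tree from a root, keeping all its edges "far": their end colours differ by at least 2.
-- Let S be its vertex set.  If no far edge leaves S, then the end colours of every edge leaving S
-- are consecutive.  Take such an edge, from colour i in S to colour j outside, and a colour m
-- far from both i and j.  Transposing j and m outside S keeps the colouring proper and makes the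
-- edge far.  Such an m exists unless k = 4 and {i, j} consists of the two middle colours.
-- If every edge leaving S is of this last kind, the end colour m far from i will do, as no edge
-- leaving S has an end of colour m.
-- So with k ≥ 4 available colours the tree extends until it spans.  Two colours can simply be
-- spread to 0 and 2.  For the lower bounds, in a backbone 3-colouring no vertex can have the
-- middle colour, since every vertex has a tree neighbour.
module Submission where

open import Defs
open import Data.Empty using (⊥-elim)
open import Data.Fin.Base using (Fin; zero; suc; toℕ; inject₁)
open import Data.Fin.Permutation.Components using (transpose; transpose-inverse)
open import Data.Fin.Properties using (any?; all?; ¬∀⟶∃¬; inject₁-injective) renaming (_≟_ to _≟ᶠ_)
open import Data.Fin.Subset using (Subset; _∈_; _∉_; _⊃_; _∪_; ⁅_⁆)
open import Data.Fin.Subset.Induction using (⊃-wellFounded)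
open import Data.Fin.Subset.Properties
  using (_∈?_; x∈⁅x⁆; x∈⁅y⁆⇒x≡y; p⊆p∪q; q⊆p∪q; x∈p∪q⁻)
open import Data.List.Base using ([]; _∷_; _∷ʳ_)
import Data.List.Membership.Propositional as List
open import Data.List.Relation.Binary.Permutation.Propositional using (↭⇒↭ₛ)
open import Data.List.Relation.Binary.Permutation.Propositional.Properties using (∷↭∷ʳ)
import Data.List.Relation.Binary.Permutation.Setoid.Properties as Permutation
open import Data.List.Relation.Unary.All using ([]; _∷_) renaming (lookup to All-lookup)
open import Data.List.Relation.Unary.AllPairs using (_∷_)
open import Data.List.Relation.Unary.Any using (here; there)
open import Data.List.Relation.Unary.Linked using (Linked; _∷_)
open import Data.List.Relation.Unary.Unique.Propositional using (Unique)
open import Data.Nat.Base using (ℕ; zero; suc; _+_; _≤_; _<_; z≤n; s≤s; ∣_-_∣)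
open import Data.Nat.Induction using (<-wellFounded)
open import Data.Nat.Properties
  using (_≤?_; ≤-antisym; ≤-refl; <-trans; <-irrefl; <-asym; ≤∧≢⇒<; ∣-∣-comm)
open import Data.Product.Base using (∃; ∃₂; _×_; _,_; proj₁; proj₂)
open import Data.Sum.Base using (_⊎_; inj₁; inj₂; swap)
open import Data.Vec.Functional using (updateAt)
open import Data.Vec.Functional.Properties using (updateAt-updates; updateAt-minimal)
open import Function.Base using (_∘_; const)
open import Induction.WellFounded using (Acc; acc)
open import Level using (0ℓ)
open import Relation.Binary.Construct.Closure.ReflexiveTransitive using (Star; ε; _◅_; _◅◅_; reverse)
open import Relation.Binary.Core using (Rel)
open import Relation.Binary.PropositionalEquality
  using (_≡_; _≢_; refl; sym; trans; cong; subst; subst₂; setoid)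
open import Relation.Nullary.Decidable using (Dec; yes; no; _×-dec_; _⊎-dec_; ¬?)
open import Relation.Nullary.Negation using (¬_; contradiction)

-- Relations in which every element has at most one parent, of smaller rank

module _ {A : Set} (Parent : Rel A 0ℓ) (rank : A → ℕ)
         (unique : ∀ {a b c} → Parent a b → Parent a c → b ≡ c)
         (rank-< : ∀ {a b} → Parent a b → rank b < rank a) where

  private
    Edge : Rel A 0ℓ
    Edge a b = Parent a b ⊎ Parent b a

  -- A path without repetition can go from child to parent only before it first goes from parent
  -- to child.

  path-from-parent : ∀ {a b} xs {z} → Parent b a → Unique (a ∷ b ∷ (xs ∷ʳ z)) →
                     Linked Edge (b ∷ (xs ∷ʳ z)) →
                     rank b < rank z × ∃ λ y → y List.∈ (b ∷ xs) × Parent z y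
  path-from-parent [] ba ((_ ∷ a≢z ∷ []) ∷ _) (inj₁ bz ∷ _) = contradiction (unique ba bz) a≢z
  path-from-parent [] ba _ (inj₂ zb ∷ _) = rank-< zb , _ , here refl , zb
  path-from-parent (c ∷ xs) ba ((_ ∷ a≢c ∷ _) ∷ _) (inj₁ bc ∷ _) =
    contradiction (unique ba bc) a≢c
  path-from-parent (c ∷ xs) ba (_ ∷ u) (inj₂ cb ∷ l) =
    let lt , y , y∈ , zy = path-from-parent xs cb u l
    in <-trans (rank-< cb) lt , y , there y∈ , zy

  path-end : ∀ {b} xs {z} → Unique (b ∷ (xs ∷ʳ z)) → Linked Edge (b ∷ (xs ∷ʳ z)) →
             rank z < rank b ⊎ ∃ λ y → y List.∈ (b ∷ xs) × Parent z y
  path-end [] u (inj₁ bz ∷ _) = inj₁ (rank-< bz)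
  path-end [] u (inj₂ zb ∷ _) = inj₂ (_ , here refl , zb)
  path-end (c ∷ xs) (_ ∷ u) (inj₁ bc ∷ l) with path-end xs u l
  ... | inj₁ lt = inj₁ (<-trans lt (rank-< bc))
  ... | inj₂ (y , y∈ , zy) = inj₂ (y , there y∈ , zy)
  path-end (c ∷ xs) u (inj₂ cb ∷ l) =
    let _ , y , y∈ , zy = path-from-parent xs cb u l in inj₂ (y , there y∈ , zy)

  -- Split by the directions of the first two edges. Two parents of `w` would force `v ≡ x`. A
  -- descent from `v` continues, so rank increases all the way round. If the path ascends to `w`,
  -- then on returning it either has only ascended, so rank decreases all the way round, or it
  -- reaches `v` from a parent in `x ∷ xs`, which must be `w`, a repetition.
  no-closed-path : ∀ {v w x} xs → Unique (v ∷ w ∷ x ∷ xs) →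
                   ¬ Linked Edge (v ∷ w ∷ x ∷ (xs ∷ʳ v))
  no-closed-path {v} {w} {x} xs uniq@((_ ∷ v≢x ∷ _) ∷ (w≢ ∷ _)) (vw ∷ wx ∷ l) = go vw wx
    where
    uniq′ : Unique (w ∷ x ∷ (xs ∷ʳ v))
    uniq′ = Permutation.Unique-resp-↭ (setoid A) (↭⇒↭ₛ (∷↭∷ʳ v (w ∷ x ∷ xs))) uniq
    uniq″ : Unique (x ∷ (xs ∷ʳ v))
    uniq″ with _ ∷ u ← uniq′ = u
    meets-w : ∀ {y} → y List.∈ (x ∷ xs) → Parent v y → ¬ Parent v w
    meets-w y∈ vy vw = All-lookup w≢ y∈ (unique vw vy)
    go : Edge v w → ¬ Edge w x
    go (inj₂ wv) (inj₁ wx) = v≢x (unique wv wx)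
    go (inj₂ wv) (inj₂ xw) =
      <-asym (rank-< wv) (<-trans (rank-< xw) (proj₁ (path-from-parent xs xw uniq′ l)))
    go (inj₁ vw) (inj₂ xw) =
      let _ , _ , y∈ , vy = path-from-parent xs xw uniq′ l in meets-w y∈ vy vw
    go (inj₁ vw) (inj₁ wx) with path-end xs uniq″ l
    ... | inj₁ lt = <-asym lt (<-trans (rank-< wx) (rank-< vw))
    ... | inj₂ (_ , y∈ , vy) = meets-w y∈ vy vw

-- Rooted trees on a set of vertices

-- `parent` and `depth` are total, but `step` constrains them only at the non-root vertices of `S`.
-- Decreasing `depth` excludes cycles; `R` is read from child to parent.
record Arborescence {n : ℕ} (R : Rel (Fin n) 0ℓ) (S : Subset n) : Set where
  field
    root   : Fin n
    root∈  : root ∈ S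
    parent : Fin n → Fin n
    depth  : Fin n → ℕ
    step   : ∀ {v} → v ∈ S → v ≢ root →
             parent v ∈ S × depth (parent v) < depth v × R v (parent v)

module _ {n : ℕ} {R : Rel (Fin n) 0ℓ} where

  singleton : ∀ r → Arborescence R ⁅ r ⁆
  singleton r = record
    -- `parent` and `depth` get default values: the only vertex is the root.
    { root = r ; root∈ = x∈⁅x⁆ r ; parent = λ v → v ; depth = const 0
    ; step = λ v∈ v≢r → contradiction (x∈⁅y⁆⇒x≡y r v∈) v≢r }

  -- The implication is asked only inside `S`, because recolouring preserves far edges there and
  -- perhaps nowhere else.
  Arborescence-map : ∀ {R′ : Rel (Fin n) 0ℓ} {S} →
                     (∀ {u v} → u ∈ S → v ∈ S → R u v → R′ u v) →
                     Arborescence R S → Arborescence R′ S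
  Arborescence-map f A = record
    { root = root ; root∈ = root∈ ; parent = parent ; depth = depth
    ; step = λ v∈ v≢r → let p∈ , lt , r = step v∈ v≢r in p∈ , lt , f v∈ p∈ r }
    where open Arborescence A

  addLeaf : ∀ {S u v} → u ∈ S → v ∉ S → R v u → Arborescence R S → Arborescence R (S ∪ ⁅ v ⁆)
  addLeaf {S} {u} {v} u∈ v∉ r A = record
    { root = root ; root∈ = p⊆p∪q _ root∈ ; parent = parent′ ; depth = depth′ ; step = step′ }
    where
    open Arborescence A
    parent′ : Fin n → Fin n
    parent′ = updateAt parent v (const u)
    depth′ : Fin n → ℕ
    depth′ = updateAt depth v (const (suc (depth u)))
    old : ∀ {w} → w ∈ S → w ≢ v
    old w∈ refl = v∉ w∈
    depth-old : ∀ {w} → w ∈ S → depth′ w ≡ depth w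
    depth-old w∈ = updateAt-minimal _ v depth (old w∈)
    step′ : ∀ {w} → w ∈ S ∪ ⁅ v ⁆ → w ≢ root →
            parent′ w ∈ S ∪ ⁅ v ⁆ × depth′ (parent′ w) < depth′ w × R w (parent′ w)
    step′ {w} w∈ w≢r with x∈p∪q⁻ S ⁅ v ⁆ w∈
    ... | inj₁ w∈S rewrite updateAt-minimal w v {const u} parent (old w∈S) =
      let p∈ , lt , r = step w∈S w≢r
      in p⊆p∪q _ p∈ , subst₂ _<_ (sym (depth-old p∈)) (sym (depth-old w∈S)) lt , r
    ... | inj₂ w∈v with refl ← x∈⁅y⁆⇒x≡y v w∈v
        rewrite updateAt-updates v {const u} parent =
      p⊆p∪q _ u∈ ,
      subst₂ _<_ (sym (depth-old u∈)) (sym (updateAt-updates v depth)) ≤-refl , r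

-- The spanning tree of an arborescence on all vertices

module SpanningTree {n : ℕ} (G : Graph n) {R : Rel (Fin n) 0ℓ} {S : Subset n}
                    (R⇒Adj : ∀ {u v} → R u v → Graph.Adj G u v)
                    (A : Arborescence R S) (full : ∀ v → v ∈ S) where
  open Arborescence A

  Parent : Rel (Fin n) 0ℓ
  Parent u v = u ≢ root × parent u ≡ v

  parent? : ∀ u v → Dec (Parent u v)
  parent? u v = ¬? (u ≟ᶠ root) ×-dec (parent u ≟ᶠ v)

  Parent-unique : ∀ {u v w} → Parent u v → Parent u w → v ≡ w
  Parent-unique (_ , p) (_ , q) = trans (sym p) q

  Parent-depth : ∀ {u v} → Parent u v → depth v < depth u
  Parent-depth (u≢r , refl) = proj₁ (proj₂ (step (full _) u≢r))

  Parent⇒R : ∀ {u v} → Parent u v → R u v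
  Parent⇒R (u≢r , refl) = proj₂ (proj₂ (step (full _) u≢r))

  Edge : Rel (Fin n) 0ℓ
  Edge u v = Parent u v ⊎ Parent v u

  Edge⇒R : ∀ {u v} → Edge u v → R u v ⊎ R v u
  Edge⇒R (inj₁ p) = inj₁ (Parent⇒R p)
  Edge⇒R (inj₂ p) = inj₂ (Parent⇒R p)

  tree : SpanningSubgraph G
  tree = record
    { graph = record
      { Adj    = Edge
      ; irrefl = λ { refl (inj₁ p) → <-irrefl refl (Parent-depth p)
                   ; refl (inj₂ p) → <-irrefl refl (Parent-depth p) }
      ; symm   = swap
      ; adj?   = λ u v → parent? u v ⊎-dec parent? v u
      }
    ; sub = λ { (inj₁ p) → R⇒Adj (Parent⇒R p)
              ; (inj₂ p) → Graph.symm G (R⇒Adj (Parent⇒R p)) }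
    }

  to-root : ∀ v → Acc _<_ (depth v) → Star Edge v root
  to-root v (acc rec) with v ≟ᶠ root
  ... | yes refl = ε
  ... | no v≢r   = inj₁ (v≢r , refl) ◅ to-root (parent v) (rec (Parent-depth (v≢r , refl)))

  tree-isTree : IsTree (SpanningSubgraph.graph tree)
  tree-isTree = connected , acyclic
    where
    connected : ∀ u v → Star Edge u v
    connected u v = to-root u (<-wellFounded _) ◅◅ reverse swap (to-root v (<-wellFounded _))
    acyclic : Acyclic (SpanningSubgraph.graph tree)
    acyclic v []           (s≤s () , _)
    acyclic v (w ∷ [])     (s≤s (s≤s ()) , _)
    acyclic v (w ∷ x ∷ xs) (_ , u , l) =
      no-closed-path Parent depth Parent-unique Parent-depth xs u l

-- Connected graphs

module _ {n : ℕ} {R : Rel (Fin n) 0ℓ} where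

  -- The first step of the walk that ends outside `S`.
  leaving-edge : ∀ (S : Subset n) {u v} → Star R u v → u ∈ S → v ∉ S →
                 ∃₂ λ x y → x ∈ S × y ∉ S × R x y
  leaving-edge S ε u∈ v∉ = contradiction u∈ v∉
  leaving-edge S (_◅_ {j = w} r rs) u∈ v∉ with w ∈? S
  ... | yes w∈ = leaving-edge S rs w∈ v∉
  ... | no w∉  = _ , w , u∈ , w∉ , r

another : ∀ {n} → 2 ≤ n → (v : Fin n) → ∃ λ w → v ≢ w
another (s≤s (s≤s _)) zero    = suc zero , λ ()
another (s≤s (s≤s _)) (suc v) = zero , λ ()

neighbour : ∀ {n} → 2 ≤ n → (G : Graph n) → Connected G → ∀ v → ∃ λ w → Graph.Adj G v w
neighbour 2≤n G conn v with another 2≤n v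
... | w , v≢w with conn v w
...   | ε     = contradiction refl v≢w
...   | a ◅ _ = _ , a

-- Colours

Far : ∀ {k} → Fin k → Fin k → Set
Far i j = 2 ≤ ∣ toℕ i - toℕ j ∣

far? : ∀ {k} (i j : Fin k) → Dec (Far i j)
far? i j = 2 ≤? ∣ toℕ i - toℕ j ∣

Far-sym : ∀ {k} (i j : Fin k) → Far i j → Far j i
Far-sym i j = subst (2 ≤_) (∣-∣-comm (toℕ i) (toℕ j))

Far-irrefl : ∀ {k} (i : Fin k) → ¬ Far i i
Far-irrefl zero    ()
Far-irrefl (suc i) = Far-irrefl i

data Central : ∀ {k} → Fin k → Fin k → Set where
  up   : Central {4} (suc zero) (suc (suc zero))
  down : Central {4} (suc (suc zero)) (suc zero)

FarFromBoth : ∀ {k} → Fin k → Fin k → Set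
FarFromBoth i j = ∃ λ m → Far m i × Far m j

-- Colour 0 is far from all colours from 2 on, and colour 3 is far from 0 and 1. The only other
-- close pair is 1 and 2, for which colour 4 serves once it exists.
farFromBoth-or-central : ∀ {k} → 4 ≤ k → (i j : Fin k) → ¬ Far i j →
                         FarFromBoth i j ⊎ Central i j
farFromBoth-or-central (s≤s (s≤s (s≤s (s≤s z≤n)))) = go
  where
  far : ∀ {a} → 2 ≤ suc (suc a)
  far = s≤s (s≤s z≤n)
  go : ∀ {d} (i j : Fin (4 + d)) → ¬ Far i j → FarFromBoth i j ⊎ Central i j
  go (suc (suc i)) (suc (suc j)) _ = inj₁ (zero , far , far)
  go zero zero _ = inj₁ (suc (suc (suc zero)) , far , far)
  go zero (suc zero) _ = inj₁ (suc (suc (suc zero)) , far , far)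
  go (suc zero) zero _ = inj₁ (suc (suc (suc zero)) , far , far)
  go (suc zero) (suc zero) _ = inj₁ (suc (suc (suc zero)) , far , far)
  go zero (suc (suc j)) ¬far = contradiction far ¬far
  go (suc (suc i)) zero ¬far = contradiction far ¬far
  go (suc zero) (suc (suc (suc j))) ¬far = contradiction far ¬far
  go (suc (suc (suc i))) (suc zero) ¬far = contradiction far ¬far
  go {zero} (suc zero) (suc (suc zero)) _ = inj₂ up
  go {zero} (suc (suc zero)) (suc zero) _ = inj₂ down
  go {suc d} (suc zero) (suc (suc zero)) _ = inj₁ (suc (suc (suc (suc zero))) , far , far)
  go {suc d} (suc (suc zero)) (suc zero) _ = inj₁ (suc (suc (suc (suc zero))) , far , far)

transpose-injective : ∀ {k} (i j : Fin k) {x y} → transpose i j x ≡ transpose i j y → x ≡ y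
transpose-injective i j eq =
  trans (sym (transpose-inverse j i)) (trans (cong (transpose j i) eq) (transpose-inverse j i))

transpose-first : ∀ {k} (i j : Fin k) → transpose i j i ≡ j
transpose-first i j with i ≟ᶠ i
... | yes _   = refl
... | no  i≢i = contradiction refl i≢i

-- A clash could only be new if `j′` moves. Then `i′` and `j′` would be `j` and `m` in some order,
-- hence far.
transpose-avoids : ∀ {k} (j m : Fin k) → Far m j → ∀ {i′ j′} → i′ ≢ j′ → ¬ Far i′ j′ →
                   i′ ≢ transpose j m j′
transpose-avoids j m mj {i′} {j′} i′≢j′ ¬far with j′ ≟ᶠ j
... | yes refl = λ { refl → ¬far mj }
... | no _ with j′ ≟ᶠ m
...   | yes refl = λ { refl → ¬far (Far-sym m j mj) }
...   | no _     = i′≢j′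

-- Here `m` is the end colour beyond `j`. A central `j′` is either `j`, sent to the non-central `m`,
-- or `i`, which is fixed.
central-transpose : ∀ {k} {i j : Fin k} → Central i j →
                    ∃ λ m → Far i m × (∀ {i′ j′} → Central i′ j′ → i′ ≢ transpose j m j′)
central-transpose up   = suc (suc (suc zero)) , s≤s (s≤s z≤n) , λ { up () ; down () }
central-transpose down = zero , s≤s (s≤s z≤n) , λ { up () ; down () }

-- Growing the tree

module _ {n : ℕ} (G : Graph n) {k : ℕ} where
  open Graph G

  Colouring : Set
  Colouring = Fin n → Fin k

  FarEdge : Colouring → Rel (Fin n) 0ℓ
  FarEdge c u v = Adj u v × Far (c u) (c v)

  Leaving : Subset n → Rel (Fin n) 0ℓ
  Leaving S u v = u ∈ S × v ∉ S × Adj u v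

  -- One round of growth. `agree` keeps the edges of the present tree far, and `leaving` with `far`
  -- supplies the next one. `Inv` is left abstract to serve both proper colourings and colourings
  -- that make every edge far.
  record Recolouring (Inv : Colouring → Set) (c : Colouring) (S : Subset n) : Set where
    constructor recolouring
    field
      {colour} : Colouring
      inv      : Inv colour
      agree    : ∀ {v} → v ∈ S → c v ≡ colour v
      {u v}    : Fin n
      leaving  : Leaving S u v
      far      : Far (colour u) (colour v)

  Spanned : (Colouring → Set) → Set
  Spanned Inv = ∃ λ c → Inv c × ∃ λ S → Arborescence (FarEdge c) S × (∀ v → v ∈ S)

  module _ (Inv : Colouring → Set)
           (recolour : ∀ {c S} → Inv c → ∃₂ (Leaving S) → Recolouring Inv c S)
           (conn : Connected G) where

    grow : ∀ {c} S → Acc _⊃_ S →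
           Inv c → Arborescence (FarEdge c) S → Spanned Inv
    grow {c} S (acc rec) ic A with all? (_∈? S)
    ... | yes full = c , ic , S , A , full
    ... | no ¬full =
      let v , v∉ = ¬∀⟶∃¬ _ _ (_∈? S) ¬full
          recolouring {c′} inv agree {x} {y} (x∈ , y∉ , a) far =
            recolour ic (leaving-edge S (conn (Arborescence.root A) v) (Arborescence.root∈ A) v∉)
      in grow (S ∪ ⁅ y ⁆) (rec (p⊆p∪q _ , y , q⊆p∪q _ _ (x∈⁅x⁆ y) , y∉)) inv
           -- The edge is reversed, since the new leaf `y` is the child.
           (addLeaf x∈ y∉ (symm a , Far-sym (c′ x) (c′ y) far)
             (Arborescence-map (λ u∈ w∈ (a , f) → a , subst₂ Far (agree u∈) (agree w∈) f) A))

    span : Fin n → ∀ {c} → Inv c → Spanned Inv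
    span r ic = grow ⁅ r ⁆ (⊃-wellFounded _) ic (singleton r)

  module _ {c : Colouring} {S : Subset n} (proper : IsProper G k c) where

    -- Edges inside `S` keep their colours, edges outside stay proper by injectivity, and `avoids`
    -- handles those crossing.
    recolour-outside : (π : Fin k → Fin k) → (∀ {i j} → π i ≡ π j → i ≡ j) →
                       (∀ {u v} → Leaving S u v → c u ≢ π (c v)) →
                       ∀ {u v} → Leaving S u v → Far (c u) (π (c v)) →
                       Recolouring (IsProper G k) c S
    recolour-outside π injective avoids l@(u∈ , v∉ , _) far =
      recolouring proper′ inside l (subst₂ Far (inside u∈) (outside v∉) far)
      where
      c′ : Colouring
      c′ w with w ∈? S
      ... | yes _ = c w
      ... | no _  = π (c w)
      inside : ∀ {w} → w ∈ S → c w ≡ c′ w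
      inside {w} w∈ with w ∈? S
      ... | yes _ = refl
      ... | no w∉ = contradiction w∈ w∉
      outside : ∀ {w} → w ∉ S → π (c w) ≡ c′ w
      outside {w} w∉ with w ∈? S
      ... | yes w∈ = contradiction w∈ w∉
      ... | no _   = refl
      proper′ : IsProper G k c′
      proper′ x y a with x ∈? S | y ∈? S
      ... | yes _  | yes _  = proper x y a
      ... | yes x∈ | no y∉  = avoids (x∈ , y∉ , a)
      ... | no x∉  | yes y∈ = avoids (y∈ , x∉ , symm a) ∘ sym
      ... | no _   | no _   = proper x y a ∘ injective

    recolour-transpose : ∀ {u v} → Leaving S u v → ∀ m → Far (c u) m →
                         (∀ {x y} → Leaving S x y → c x ≢ transpose (c v) m (c y)) →
                         Recolouring (IsProper G k) c S
    recolour-transpose {u} {v} l m far avoids =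
      recolour-outside (transpose (c v) m) (transpose-injective (c v) m) avoids l
        (subst (Far (c u)) (sym (transpose-first (c v) m)) far)

    leaving? : {P : Fin n → Fin n → Set} → (∀ u v → Dec (P u v)) →
               Dec (∃₂ λ u v → Leaving S u v × P u v)
    leaving? P? = any? λ u → any? λ v →
      ((u ∈? S) ×-dec ¬? (v ∈? S) ×-dec adj? u v) ×-dec P? u v

    recolour : 4 ≤ k → ∃₂ (Leaving S) → Recolouring (IsProper G k) c S
    recolour 4≤k (u₀ , v₀ , l₀) with leaving? (λ u v → far? (c u) (c v))
    ... | yes (u , v , l , far) = recolouring proper (λ _ → refl) l far
    ... | no close
        with leaving? (λ u v → any? λ m → far? m (c u) ×-dec far? m (c v))
    -- `mu` makes the edge far after the transposition; `mv` excludes clashes on all leaving edges,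
    -- none of which is far.
    ...   | yes (u , v , l , m , mu , mv) = recolour-transpose l m (Far-sym m (c u) mu)
              λ l′ → transpose-avoids (c v) m mv (proper _ _ (proj₂ (proj₂ l′)))
                       λ far → close (_ , _ , l′ , far)
    ...   | no none =
      -- All leaving edges are now central, so the given `l₀` is as good as any.
      let m , far , avoids = central-transpose (central l₀)
      in recolour-transpose l₀ m far λ l → avoids (central l)
      where
      central : ∀ {u v} → Leaving S u v → Central (c u) (c v)
      central {u} {v} l
          with farFromBoth-or-central 4≤k (c u) (c v) (λ far → close (_ , _ , l , far))
      ... | inj₁ m = contradiction (_ , _ , l , m) none
      ... | inj₂ z = z

-- Spanning trees with backbone colourings

module _ {n : ℕ} (G : Graph n) (conn : Connected G) (r : Fin n) where

  TreeBackbone : ℕ → Set₁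
  TreeBackbone k =
    ∃ λ (T : SpanningSubgraph G) → IsTree (SpanningSubgraph.graph T) × Backbone₂Colourable G T k

  spanned⇒treeBackbone : ∀ {k Inv} → (∀ {c} → Inv c → IsProper G k c) →
                         Spanned G Inv → TreeBackbone k
  spanned⇒treeBackbone proper (c , ic , S , A , full) =
    tree , tree-isTree , c , proper ic , λ u v e → far (Edge⇒R e)
    where
    open SpanningTree G proj₁ A full
    far : ∀ {u v} → FarEdge G c u v ⊎ FarEdge G c v u → Far (c u) (c v)
    far         (inj₁ (_ , f)) = f
    far {u} {v} (inj₂ (_ , f)) = Far-sym (c v) (c u) f

  treeBackbone-≥4 : ∀ {k} → 4 ≤ k → Colourable G k → TreeBackbone k
  treeBackbone-≥4 4≤k (c , proper) = spanned⇒treeBackbone (λ p → p)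
    (span G (IsProper G _) (λ p → recolour G p 4≤k) conn r proper)

  -- After spreading, every edge of `G` is far, so the tree grows along any leaving edge without
  -- recolouring.
  treeBackbone-bipartite : Colourable G 2 → TreeBackbone 3
  treeBackbone-bipartite (c , proper) = spanned⇒treeBackbone far⇒proper
    (span G AllFar (λ { p (_ , _ , l@(_ , _ , a)) → recolouring p (λ _ → refl) l (p _ _ a) })
      conn r {spread ∘ c} (λ u v a → spread-far (c u) (c v) (proper u v a)))
    where
    AllFar : (Fin n → Fin 3) → Set
    AllFar c = ∀ u v → Graph.Adj G u v → Far (c u) (c v)
    far⇒proper : ∀ {c} → AllFar c → IsProper G 3 c
    far⇒proper {c} far u v a eq = Far-irrefl (c v) (subst (λ i → Far i (c v)) eq (far u v a))
    spread : Fin 2 → Fin 3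
    spread zero       = zero
    spread (suc zero) = suc (suc zero)
    spread-far : ∀ i j → i ≢ j → Far (spread i) (spread j)
    spread-far zero       zero       i≢j = contradiction refl i≢j
    spread-far zero       (suc zero) i≢j = s≤s (s≤s z≤n)
    spread-far (suc zero) zero       i≢j = s≤s (s≤s z≤n)
    spread-far (suc zero) (suc zero) i≢j = contradiction refl i≢j

-- Lower bounds

Colourable-suc : ∀ {n} {G : Graph n} {k} → Colourable G k → Colourable G (suc k)
Colourable-suc (c , proper) =
  inject₁ ∘ c , λ u v a eq → proper u v a (inject₁-injective eq)

¬Colourable-1 : ∀ {n} → 2 ≤ n → (G : Graph n) → Connected G → Fin n → ¬ Colourable G 1
¬Colourable-1 2≤n G conn v (c , proper) with neighbour 2≤n G conn v
... | w , a with c v | c w | proper v w a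
...   | zero | zero | ≢ = ≢ refl

module _ {n : ℕ} (2≤n : 2 ≤ n) {G : Graph n} (T : SpanningSubgraph G)
         (conn : Connected (SpanningSubgraph.graph T)) where
  open SpanningSubgraph T

  far-neighbour : ∀ {k} ((c , _) : Backbone₂Colourable G T k) → ∀ v → ∃ λ i → Far (c v) i
  far-neighbour (c , _ , far) v = let w , a = neighbour 2≤n graph conn v in c w , far v w a

  ¬Backbone₂Colourable-2 : Fin n → ¬ Backbone₂Colourable G T 2
  ¬Backbone₂Colourable-2 v b@(c , _) = let i , f = far-neighbour b v in none (c v) i f
    where
    none : ∀ (i j : Fin 2) → ¬ Far i j
    none zero       zero       ()
    none zero       (suc zero) (s≤s ())
    none (suc zero) zero       (s≤s ())
    none (suc zero) (suc zero) ()

  -- No colour is far from 1, so only 0 and 2 occur, and `squash` is injective on these.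
  Backbone₂Colourable-3⇒Colourable-2 : Backbone₂Colourable G T 3 → Colourable G 2
  Backbone₂Colourable-3⇒Colourable-2 b@(c , proper , _) =
    squash ∘ c , λ u v a eq →
      proper u v a (squash-injective (far-neighbour b u) (far-neighbour b v) eq)
    where
    squash : Fin 3 → Fin 2
    squash zero    = zero
    squash (suc _) = suc zero
    squash-injective : ∀ {i j} → ∃ (Far i) → ∃ (Far j) → squash i ≡ squash j → i ≡ j
    squash-injective {zero} {zero} _ _ _ = refl
    squash-injective {suc (suc zero)} {suc (suc zero)} _ _ _ = refl
    squash-injective {suc zero} (zero , s≤s ()) _ _
    squash-injective {suc zero} (suc zero , ()) _ _
    squash-injective {suc zero} (suc (suc zero) , s≤s ()) _ _
    squash-injective {suc (suc zero)} {suc zero} _ (zero , s≤s ()) _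
    squash-injective {suc (suc zero)} {suc zero} _ (suc zero , ()) _
    squash-injective {suc (suc zero)} {suc zero} _ (suc (suc zero) , s≤s ()) _

-- The backbone chromatic number of the tree

IsLeast-unique : ∀ {P : ℕ → Set} {j k} → IsLeast P j → IsLeast P k → j ≡ k
IsLeast-unique (pj , ≤j) (pk , ≤k) = ≤-antisym (≤j _ pk) (≤k _ pj)

BBC₂-least : ∀ {n} (G : Graph n) T {k} → 1 ≤ k → Backbone₂Colourable G T k →
             (∀ j → 1 ≤ j → Backbone₂Colourable G T j → k ≤ j) → BBC₂ G T ≡ k
BBC₂-least G T 1≤k b lower =
  IsLeast-unique (proj₂ (BBC₂-exists G T)) ((1≤k , b) , λ { j (1≤j , bj) → lower j 1≤j bj })

module _ {n : ℕ} (2≤n : 2 ≤ n) (G : Graph n) (conn : Connected G) (r : Fin n) where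

  -- Stated for a variable `k` in place of `χ G`, so that its value can be matched on.
  backbone-spanningTree : ∀ {k} → IsLeast (λ k → 1 ≤ k × Colourable G k) k →
    ∃ λ (T : SpanningSubgraph G) →
      IsTree (SpanningSubgraph.graph T) ×
      (4 ≤ k → BBC₂ G T ≡ k) ×
      (¬ (4 ≤ k) → BBC₂ G T ≡ k + 1)
  backbone-spanningTree {0} ((() , _) , _)
  backbone-spanningTree {1} ((_ , col) , _) = ⊥-elim (¬Colourable-1 2≤n G conn r col)
  backbone-spanningTree {2} ((_ , col) , least)
    with T , isTree , b ← treeBackbone-bipartite G conn r col =
    T , isTree , (λ { (s≤s (s≤s ())) }) ,
    λ _ → BBC₂-least G T (s≤s z≤n) b λ { j 1≤j bj@(c , p , _) →
      -- A backbone colouring is proper, so `2 ≤ j`; equality is excluded separately.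
      ≤∧≢⇒< (least j (1≤j , c , p))
        λ { refl → ¬Backbone₂Colourable-2 2≤n T (proj₁ isTree) r bj } }
  backbone-spanningTree {3} ((_ , col) , least)
    -- A spare fourth colour brings the growing argument within reach.
    with T , isTree , b ← treeBackbone-≥4 G conn r ≤-refl (Colourable-suc {G = G} col) =
    T , isTree , (λ { (s≤s (s≤s (s≤s ()))) }) ,
    λ _ → BBC₂-least G T (s≤s z≤n) b λ { j 1≤j bj@(c , p , _) →
      ≤∧≢⇒< (least j (1≤j , c , p))
        -- With `j = 3` there would be a proper 2-colouring, against the minimality of 3.
        λ { refl → <-irrefl refl (least 2 (s≤s z≤n ,
          Backbone₂Colourable-3⇒Colourable-2 2≤n T (proj₁ isTree) bj)) } }
  backbone-spanningTree {suc (suc (suc (suc k)))} ((1≤k , col) , least)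
    with T , isTree , b ← treeBackbone-≥4 G conn r (s≤s (s≤s (s≤s (s≤s z≤n)))) col =
    T , isTree ,
    (λ _ → BBC₂-least G T 1≤k b λ { j 1≤j (c , p , _) → least j (1≤j , c , p) }) ,
    λ ¬4≤k → contradiction (s≤s (s≤s (s≤s (s≤s z≤n)))) ¬4≤k

mainTheorem4 : ∀ {n : ℕ} → 2 ≤ n → (G : Graph n) → Connected G →
    ∃ λ (T : SpanningSubgraph G) →
    IsTree (SpanningSubgraph.graph T) ×
    (4 ≤ χ G → BBC₂ G T ≡ χ G) ×
    (¬ (4 ≤ χ G) → BBC₂ G T ≡ χ G + 1)
mainTheorem4 2≤n@(s≤s _) G conn = backbone-spanningTree 2≤n G conn zero (proj₂ (χ-exists G))
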